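{- Let $a>1$ be an integer, let $p$ be a prime with $p > 11+4\sqrt{7}$, let $K \ge 1$ be an integer, and let $N = 2Kp^3+1$. Suppose that $2K < \log_a(2Kp^3+1)$, that $2K < \sqrt{p}$, and that $2K$ is not a perfect cube. If $a^{N-1} \equiv 1 \pmod N$, then $N$ is prime. -}

module Defs where

open import Data.Nat.Base as ℕ using (ℕ; suc; NonZero)
open import Data.Integer.Base as ℤ using (ℤ; +_; -[1+_])
import Data.Integer.Divisibility as ℤ
open import Data.Rational.Unnormalised.Base as ℚ using (ℚᵘ; mkℚᵘ; 0ℚᵘ; _≃_)
open import Data.Product.Base using (Σ; ∃; _×_)
open import Data.Sum.Base using (_⊎_)
open import Relation.Binary.PropositionalEquality.Core using (_≡_)

infix 4 _≡_[mod_] _<ᴿ_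
infixl 6 _+ᴿ_
infixl 7 _·ᴿ_

_≡_[mod_] : ℕ → ℕ → ℕ → Set
x ≡ y [mod n ] = (+ n) ℤ.∣ (+ x ℤ.- + y)

PerfectCube : ℕ → Set
PerfectCube n = ∃ λ m → n ≡ m ℕ.^ 3

-- A real number x given by its Dedekind cut: `Lower q` means q < x and
-- `Upper q` means x < q.  The cut axioms are not recorded as fields; the
-- constructions below give the cuts of the real numbers they are named after.
record Cut : Set₁ where
  constructor cut
  field
    Lower Upper : ℚᵘ → Set

open Cut public

_<ᴿ_ : Cut → Cut → Set
x <ᴿ y = Σ ℚᵘ λ q → Upper x q × Lower y q

fromℕ : ℕ → Cut
fromℕ n = cut (λ q → q ℚ.< + n ℚ./ 1) (λ q → + n ℚ./ 1 ℚ.< q)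

_+ᴿ_ : Cut → Cut → Cut
x +ᴿ y = cut
  (λ q → Σ ℚᵘ λ r → Σ ℚᵘ λ s → Lower x r × Lower y s × q ≃ r ℚ.+ s)
  (λ q → Σ ℚᵘ λ r → Σ ℚᵘ λ s → Upper x r × Upper y s × q ≃ r ℚ.+ s)

-- The factor must be positive: multiplication by it then preserves the order.
_·ᴿ_ : (c : ℕ) .{{_ : NonZero c}} → Cut → Cut
c ·ᴿ x = cut
  (λ q → Σ ℚᵘ λ r → Lower x r × q ≃ (+ c ℚ./ 1) ℚ.* r)
  (λ q → Σ ℚᵘ λ r → Upper x r × q ≃ (+ c ℚ./ 1) ℚ.* r)

√_ : ℕ → Cut
√ n = cut
  (λ q → q ℚ.< 0ℚᵘ ⊎ q ℚ.* q ℚ.< + n ℚ./ 1)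
  (λ q → 0ℚᵘ ℚ.< q × + n ℚ./ 1 ℚ.< q ℚ.* q)

infix 8 √_

-- Meaningful for a > 1 and x ≥ 1.  A rational m / d with d > 0 is below
-- log_a x iff a ^ (m / d) < x, that is, iff a ^ m < x ^ d; a negative exponent
-- is moved to the other side.  `mkℚᵘ m d` stands for m / (1 + d), and
-- -[1+ m ] for -(1 + m).
log : (a x : ℕ) → Cut
log a x = cut below above
  where
  below : ℚᵘ → Set
  below (mkℚᵘ (+ m)    d) = a ℕ.^ m ℕ.< x ℕ.^ suc d
  below (mkℚᵘ -[1+ m ] d) = 1 ℕ.< x ℕ.^ suc d ℕ.* a ℕ.^ suc m

  above : ℚᵘ → Set
  above (mkℚᵘ (+ m)    d) = x ℕ.^ suc d ℕ.< a ℕ.^ m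
  above (mkℚᵘ -[1+ m ] d) = x ℕ.^ suc d ℕ.* a ℕ.^ suc m ℕ.< 1

-- Write M = 2K, so that N = M p³ + 1.  As 1 < a^M < N, the order of a modulo N
-- does not divide M, so p divides it; hence N has a prime factor q ≡ 1 (mod p), and the
-- cofactor is also ≡ 1.  If N were composite, then N = (x p + 1)(y p + 1) with
-- x, y ≥ 1, and comparing with M p³ + 1 gives x + y = k p and x y + k = M p for some k.
-- Then M² < p confines the smaller root so tightly that k = y² and M = y³, or k = 1,
-- which is excluded by parity.

module Submission where

open import Data.Nat.Base using (ℕ; zero; suc; pred; _+_; _*_; _^_; _∸_; _!; _<_; _≤_; z≤n; s≤s; z<s; NonZero; >-nonZero; ≢-nonZero; ≢-nonZero⁻¹)
import Data.Integer.Base as ℤ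
import Data.Integer.Properties as ℤ
open import Data.List.Base using ([]; _∷_)
open import Data.List.Relation.Unary.All using (_∷_)
open import Data.Nat.Combinatorics using (_C_; nCk≡n!/k![n-k]!; k![n∸k]!∣n!; k>n⇒nCk≡0; nCn≡1; nCk+nC[k+1]≡[n+1]C[k+1])
open import Data.Nat.Coprimality using (Coprime; coprime-Bézout; coprime-divisor; coprime-/gcd) renaming (sym to coprime-sym)
open import Data.Nat.Divisibility
open import Data.Nat.DivMod using (_/_; _%_; m/n*n≡m; m%n<n; m≡m%n+[m/n]*n; m<n⇒m%n≡m; [m+kn]%n≡m%n)
open import Data.Nat.GCD using (gcd; gcd[m,n]∣m; gcd[m,n]∣n; gcd[m,n]≢0; module Bézout)
open import Data.Nat.Primality using (Prime; euclidsLemma; prime⇒irreducible; prime⇒nonZero; ¬prime[0]; ¬prime[1]; prime[2])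
open import Data.Nat.Primality.Factorisation using (factorise)
open import Data.Nat.Properties
open import Data.Nat.Tactic.RingSolver using (solve-∀)
open import Data.Product.Base using (∃; ∃₂; _×_; _,_; proj₁; proj₂)
open import Data.Rational.Unnormalised.Base as ℚ using (mkℚᵘ)
import Data.Rational.Unnormalised.Properties as ℚ
open import Data.Sum.Base using (_⊎_; inj₁; inj₂)
open import Relation.Binary.PropositionalEquality
open import Relation.Nullary.Decidable.Core using (Dec; yes; no)
open import Relation.Nullary.Negation.Core using (¬_; contradiction)
open import Defs

-- Elementary facts on prime divisors.

prime∤1 : ∀ {q} → Prime q → ¬ q ∣ 1
prime∤1 q-prime q∣1 = ¬prime[1] (subst Prime (∣1⇒≡1 q∣1) q-prime)

prime∣prime⇒≡ : ∀ {p q} → Prime p → Prime q → q ∣ p → q ≡ p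
prime∣prime⇒≡ p-prime q-prime q∣p with prime⇒irreducible p-prime q∣p
... | inj₁ refl = contradiction q-prime ¬prime[1]
... | inj₂ q≡p  = q≡p

prime∤⇒coprime : ∀ {p n} → Prime p → p ∤ n → Coprime p n
prime∤⇒coprime p-prime p∤n (d∣p , d∣n) with prime⇒irreducible p-prime d∣p
... | inj₁ d≡1  = d≡1
... | inj₂ refl = contradiction d∣n p∤n

prime∣^⇒∣ : ∀ {q} → Prime q → ∀ b n → q ∣ b ^ n → q ∣ b
prime∣^⇒∣ q-prime b zero    q∣1 = contradiction q∣1 (prime∤1 q-prime)
prime∣^⇒∣ q-prime b (suc n) q∣ with euclidsLemma b (b ^ n) q-prime q∣
... | inj₁ q∣b  = q∣b
... | inj₂ q∣bⁿ = prime∣^⇒∣ q-prime b n q∣bⁿ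

primeDivisor : ∀ n .{{_ : NonZero n}} → n ≢ 1 → ∃ λ q → Prime q × q ∣ n
primeDivisor n n≢1 with factorise n
... | record { factors = [] ; isFactorisation = n≡1 } = contradiction n≡1 n≢1
... | record { factors = q ∷ qs ; isFactorisation = eq ; factorsPrime = q-prime ∷ _ } =
  q , q-prime , subst (q ∣_) (sym eq) (m∣m*n _)

-- Binomial coefficients and the congruence `x ^ q ≡ x` modulo a prime `q`.

prime∤! : ∀ {q} → Prime q → ∀ k → k < q → q ∤ k !
prime∤! q-prime zero    _   q∣1 = prime∤1 q-prime q∣1
prime∤! q-prime (suc k) k<q q∣ with euclidsLemma (suc k) (k !) q-prime q∣
... | inj₁ q∣k  = >⇒∤ k<q q∣k
... | inj₂ q∣k! = prime∤! q-prime k (<⇒≤ k<q) q∣k!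

-- The product of `q C k` with the two factorials is `q !`, a multiple of `q`; as `k` and `q ∸ k`
-- are both below `q`, neither factorial is one.
prime∣C : ∀ {q} → Prime q → ∀ k → 0 < k → k < q → q ∣ q C k
prime∣C {q@(suc q-1)} q-prime k 0<k k<q with euclidsLemma (q C k) (k ! * (q ∸ k) !) q-prime q∣C*d
  where
  instance _ = k !* (q ∸ k) !≢0
  q∣C*d : q ∣ (q C k) * (k ! * (q ∸ k) !)
  q∣C*d = subst (q ∣_)
    (sym (trans (cong (_* (k ! * (q ∸ k) !)) (nCk≡n!/k![n-k]! (<⇒≤ k<q)))
                (m/n*n≡m (k![n∸k]!∣n! (<⇒≤ k<q)))))
    (m∣m*n (q-1 !))
... | inj₁ q∣C = q∣C
... | inj₂ q∣d with euclidsLemma (k !) ((q ∸ k) !) q-prime q∣d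
...   | inj₁ q∣k!  = contradiction q∣k! (prime∤! q-prime k k<q)
...   | inj₂ q∣l! = contradiction q∣l! (prime∤! q-prime (q ∸ k) (∸-monoʳ-< 0<k (<⇒≤ k<q)))

binomialPartialSum : ℕ → ℕ → ℕ → ℕ
binomialPartialSum x n zero    = 0
binomialPartialSum x n (suc m) = binomialPartialSum x n m + (n C m) * x ^ m

binomialPartialSum-pascal : ∀ x n m → binomialPartialSum x (suc n) (suc m) ≡
  binomialPartialSum x n (suc m) + x * binomialPartialSum x n m
binomialPartialSum-pascal x n zero    = cong suc (sym (*-zeroʳ x))
binomialPartialSum-pascal x n (suc m) = begin
  B (suc n) (suc m) + (suc n C suc m) * (x * x ^ m)
    ≡⟨ cong₂ (λ u v → u + v * (x * x ^ m)) (binomialPartialSum-pascal x n m)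
             (sym (nCk+nC[k+1]≡[n+1]C[k+1] n m)) ⟩
  B n (suc m) + x * B n m + (n C m + n C suc m) * (x * x ^ m)
    ≡⟨ rearrange (B n (suc m)) x (B n m) (n C m) (n C suc m) (x ^ m) ⟩
  B n (suc m) + (n C suc m) * (x * x ^ m) + x * (B n m + (n C m) * x ^ m) ∎
  where
  open ≡-Reasoning
  B = binomialPartialSum x
  rearrange : ∀ s x t c d y → s + x * t + (c + d) * (x * y) ≡ s + d * (x * y) + x * (t + c * y)
  rearrange = solve-∀

-- Terms of degree above `n` vanish, so every `m > n` is allowed. The induction needs this slack,
-- since Pascal's rule calls on the sums with `m` and with `suc m` terms.
binomial-theorem : ∀ x n m → n < m → binomialPartialSum x n m ≡ (1 + x) ^ n
binomial-theorem x zero    (suc zero)    _   = refl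
binomial-theorem x zero    (suc (suc m)) _   = begin
  binomialPartialSum x 0 (suc m) + (0 C suc m) * x ^ suc m
    ≡⟨ cong₂ (λ u v → u + v * x ^ suc m) (binomial-theorem x 0 (suc m) z<s) (k>n⇒nCk≡0 {0} {suc m} z<s) ⟩
  1 ∎
  where open ≡-Reasoning
binomial-theorem x (suc n) (suc m) (s≤s n<m) = begin
  binomialPartialSum x (suc n) (suc m)
    ≡⟨ binomialPartialSum-pascal x n m ⟩
  binomialPartialSum x n (suc m) + x * binomialPartialSum x n m
    ≡⟨ cong₂ (λ u v → u + x * v) (binomial-theorem x n (suc m) (m<n⇒m<1+n n<m)) (binomial-theorem x n m n<m) ⟩
  (1 + x) ^ suc n ∎
  where open ≡-Reasoning

-- Modulo `q` only the term of degree 0 survives.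
binomialPartialSum-prime : ∀ {q} → Prime q → ∀ x m → m < q →
  ∃ λ t → binomialPartialSum x q (suc m) ≡ 1 + t * q
binomialPartialSum-prime q-prime x zero    _   = 0 , refl
binomialPartialSum-prime {q} q-prime x (suc m) m<q
  with binomialPartialSum-prime q-prime x m (<⇒≤ m<q) | prime∣C q-prime (suc m) z<s m<q
... | t , eq | divides c eq′ = t + c * x ^ suc m ,
  trans (cong₂ (λ u v → u + v * x ^ suc m) eq eq′) (rearrange t q c (x ^ suc m))
  where
  rearrange : ∀ t q c y → 1 + t * q + c * q * y ≡ 1 + (t + c * y) * q
  rearrange = solve-∀

frobenius : ∀ {q} → Prime q → ∀ x → ∃ λ t → (1 + x) ^ q ≡ 1 + x ^ q + t * q
frobenius {q@(suc q-1)} q-prime x with binomialPartialSum-prime q-prime x q-1 (n<1+n q-1)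
... | t , eq = t , (begin
  (1 + x) ^ q                                  ≡⟨ binomial-theorem x q (suc q) (n<1+n q) ⟨
  binomialPartialSum x q q + (q C q) * x ^ q     ≡⟨ cong₂ (λ u v → u + v * x ^ q) eq (nCn≡1 q) ⟩
  1 + t * q + 1 * x ^ q                        ≡⟨ rearrange (t * q) (x ^ q) ⟩
  1 + x ^ q + t * q                            ∎)
  where
  open ≡-Reasoning
  rearrange : ∀ t y → 1 + t + 1 * y ≡ 1 + y + t
  rearrange = solve-∀

fermat-^ : ∀ {q} → Prime q → ∀ x → ∃ λ t → x ^ q ≡ x + t * q
fermat-^ {suc _} q-prime zero    = 0 , refl
fermat-^ {q} q-prime (suc x) with frobenius q-prime x | fermat-^ q-prime x
... | t , eq | s , eq′ = s + t , trans eq (trans (cong (λ u → 1 + u + t * q) eq′) (rearrange x s t q))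
  where
  rearrange : ∀ x s t q → 1 + (x + s * q) + t * q ≡ suc x + (s + t) * q
  rearrange = solve-∀

-- Powers congruent to 1.

infix 4 _≡1[_]

-- The witness `c` is `x - 1`: this avoids truncated subtraction and excludes `x = 0` for every `n`.
_≡1[_] : ℕ → ℕ → Set
x ≡1[ n ] = ∃ λ c → x ≡ suc c × n ∣ c

≡1-* : ∀ {n x y} → x ≡1[ n ] → y ≡1[ n ] → x * y ≡1[ n ]
≡1-* (c , refl , n∣c) (d , refl , n∣d) = d + c * suc d , refl , ∣m∣n⇒∣m+n n∣d (∣m⇒∣m*n (suc d) n∣c)

≡1-^ : ∀ {n x} k → x ≡1[ n ] → x ^ k ≡1[ n ]
≡1-^ zero    _   = 0 , refl , _ ∣0
≡1-^ (suc k) x≡1 = ≡1-* x≡1 (≡1-^ k x≡1)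

-- In `x * y - 1 = x * (y - 1) + (x - 1)`, `n` divides the left side and the first summand.
≡1-cancelʳ : ∀ {n x y} → y ≡1[ n ] → x * y ≡1[ n ] → x ≡1[ n ]
≡1-cancelʳ {x = zero}  _ (_ , () , _)
≡1-cancelʳ {n} {suc c} (d , refl , n∣d) (e , eq , n∣e) = c , refl ,
  ∣m+n∣m⇒∣n (subst (n ∣_) (trans (sym (suc-injective eq)) (rearrange c d)) n∣e) (∣n⇒∣m*n (suc c) n∣d)
  where
  rearrange : ∀ c d → d + c * suc d ≡ suc c * d + c
  rearrange = solve-∀

-- The relation between the exponents gives `b * (b ^ k) ^ u = (b ^ l) ^ v`, and the power of
-- `b ^ k` cancels.
≡1-bézout : ∀ {n b k l} u v → 1 + u * k ≡ v * l → b ^ k ≡1[ n ] → b ^ l ≡1[ n ] → b ≡1[ n ]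
≡1-bézout {n} {b} {k} {l} u v eq bᵏ≡1 bˡ≡1 =
  ≡1-cancelʳ (≡1-^ u bᵏ≡1) (subst _≡1[ n ] power (≡1-^ v bˡ≡1))
  where
  open ≡-Reasoning
  power : (b ^ l) ^ v ≡ b * (b ^ k) ^ u
  power = begin
    (b ^ l) ^ v       ≡⟨ ^-*-assoc b l v ⟩
    b ^ (l * v)       ≡⟨ cong (b ^_) (trans (*-comm l v) (sym eq)) ⟩
    b * b ^ (u * k)   ≡⟨ cong (λ e → b * b ^ e) (*-comm u k) ⟩
    b * b ^ (k * u)   ≡⟨ cong (b *_) (^-*-assoc b k u) ⟨
    b * (b ^ k) ^ u   ∎

≡1-coprime : ∀ {n b k l} → Coprime k l → b ^ k ≡1[ n ] → b ^ l ≡1[ n ] → b ≡1[ n ]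
≡1-coprime k⊥l bᵏ≡1 bˡ≡1 with coprime-Bézout k⊥l
... | Bézout.+- u v eq = ≡1-bézout v u eq bˡ≡1 bᵏ≡1
... | Bézout.-+ u v eq = ≡1-bézout u v eq bᵏ≡1 bˡ≡1

-- With `b ^ pred q = 1 + c`, the congruence `b ^ q ≡ b` says that `q` divides `b * c`.
fermat : ∀ {q} → Prime q → ∀ b → q ∤ b → b ^ pred q ≡1[ q ]
fermat {suc q-1} q-prime zero q∤b = contradiction (_ ∣0) q∤b
fermat {q@(suc q-1)} q-prime b@(suc _) q∤b with fermat-^ q-prime b
... | t , eq = c , bq-1≡1+c , q∣c
  where
  c = pred (b ^ q-1)
  bq-1≡1+c : b ^ q-1 ≡ suc c
  bq-1≡1+c = sym (suc-pred (b ^ q-1) {{m^n≢0 b q-1}})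
  q∣c : q ∣ c
  q∣c with euclidsLemma b c q-prime
    (divides t (+-cancelˡ-≡ b _ _ (trans (sym (*-suc b c)) (trans (cong (b *_) (sym bq-1≡1+c)) eq))))
  ... | inj₁ q∣b = contradiction q∣b q∤b
  ... | inj₂ q∣c = q∣c

-- Prime factors congruent to 1 modulo `p`.

-- For `c > 0` the factor `n + c * t` is the quotient of `(1 + c) ^ n - 1` by `c`. In this form, its
-- common divisors with `c` visibly divide `n`.
^-expansion : ∀ c n → ∃ λ t → (1 + c) ^ n ≡ 1 + c * (n + c * t)
^-expansion c zero    = 0 , cong suc (rearrange c)
  where
  rearrange : ∀ c → 0 ≡ c * (0 + c * 0)
  rearrange = solve-∀
^-expansion c (suc n) with ^-expansion c n
... | t , eq = n + t + c * t , trans (cong ((1 + c) *_) eq) (rearrange c n t)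
  where
  rearrange : ∀ c n t → (1 + c) * (1 + c * (n + c * t)) ≡ 1 + c * (suc n + c * (n + t + c * t))
  rearrange = solve-∀

-- The cofactor of gcd (b ∸ 1) n in n is > 1 and divides the cyclotomic
-- quotient (bᵖ ∸ 1) / (b ∸ 1), so b has order exactly p modulo its prime factors.
primeDivisor≡1 : ∀ {p n} .{{_ : NonZero n}} b → Prime p → p ∤ n →
  ¬ b ≡1[ n ] → b ^ p ≡1[ n ] → ∃ λ q → Prime q × q ∣ n × p ∣ pred q
primeDivisor≡1 {p@(suc _)} zero _ _ _ (_ , () , _)
primeDivisor≡1 {p} {n} (suc c) p-prime p∤n b≢1 (e , bᵖ≡1+e , n∣e)
  with ^-expansion c p
... | t , expansion = q , q-prime , q∣n , p∣q-1
  where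
  g = gcd c n
  g≢0 : g ≢ 0
  g≢0 = gcd[m,n]≢0 c n (inj₂ (≢-nonZero⁻¹ n))
  instance
    g-nonZero : NonZero g
    g-nonZero = ≢-nonZero g≢0
  m = n / g
  n≡mg : n ≡ m * g
  n≡mg = sym (m/n*n≡m (gcd[m,n]∣n c n))
  c≡ : c ≡ c / g * g
  c≡ = sym (m/n*n≡m (gcd[m,n]∣m c n))
  S = p + c * t
  -- `n` divides `e = c * S`. Dividing by `g` leaves `m ∣ c / g * S`, where `m` and `c / g` are
  -- coprime.
  m∣S : m ∣ S
  m∣S = coprime-divisor (coprime-sym (coprime-/gcd c n))
    (*-cancelʳ-∣ g (subst₂ _∣_ n≡mg e≡ n∣e))
    where
    rearrange : ∀ c′ g S → c′ * g * S ≡ c′ * S * g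
    rearrange = solve-∀
    e≡ : e ≡ c / g * S * g
    e≡ = trans (suc-injective (trans (sym bᵖ≡1+e) expansion))
               (trans (cong (_* S) c≡) (rearrange (c / g) g S))
  m≢1 : m ≢ 1
  m≢1 m≡1 = b≢1 (c , refl , subst (_∣ c) g≡n (gcd[m,n]∣m c n))
    where
    g≡n : g ≡ n
    g≡n = sym (trans n≡mg (trans (cong (_* g) m≡1) (*-identityˡ g)))
  instance
    m-nonZero : NonZero m
    m-nonZero = ≢-nonZero (λ m≡0 → ≢-nonZero⁻¹ n (trans n≡mg (cong (_* g) m≡0)))
  factor = primeDivisor m m≢1
  q = proj₁ factor
  q-prime = proj₁ (proj₂ factor)
  q∣m = proj₂ (proj₂ factor)
  q∣n : q ∣ n
  q∣n = subst (q ∣_) (sym n≡mg) (∣m⇒∣m*n g q∣m)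
  -- A prime dividing both `c` and `S = p + c * t` divides `p`, so it would be `p` itself, yet
  -- `p ∤ n`.
  q∤c : q ∤ c
  q∤c q∣c = p∤n (subst (_∣ n) (prime∣prime⇒≡ p-prime q-prime q∣p) q∣n)
    where
    q∣p : q ∣ p
    q∣p = ∣m+n∣m⇒∣n (subst (q ∣_) (+-comm p (c * t)) (∣-trans q∣m m∣S)) (∣m⇒∣m*n t q∣c)
  bᵖ≡1[q] : suc c ^ p ≡1[ q ]
  bᵖ≡1[q] = e , bᵖ≡1+e , ∣-trans q∣n n∣e
  q∤b : q ∤ suc c
  q∤b q∣b = prime∤1 q-prime
    (∣m+n∣m⇒∣n (subst (q ∣_) (trans bᵖ≡1+e (+-comm 1 e)) (q∣bᵖ p)) (∣-trans q∣n n∣e))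
    where
    q∣bᵖ : ∀ k → .{{NonZero k}} → q ∣ suc c ^ k
    q∣bᵖ (suc k) = ∣m⇒∣m*n (suc c ^ k) q∣b
    instance _ = prime⇒nonZero p-prime
  -- Otherwise `p` and `q - 1` are coprime exponents giving 1 modulo `q`, which forces `suc c ≡ 1`,
  -- against `q∤c`.
  p∣q-1 : p ∣ pred q
  p∣q-1 with p ∣? pred q
  ... | yes p∣q-1 = p∣q-1
  ... | no p∤q-1 with ≡1-coprime (prime∤⇒coprime p-prime p∤q-1) bᵖ≡1[q] (fermat q-prime (suc c) q∤b)
  ...   | _ , refl , q∣c = contradiction q∣c q∤c

-- The quadratic equation behind a factorisation.

2∣n*n+n : ∀ n → 2 ∣ n * n + n
2∣n*n+n zero    = _ ∣0
2∣n*n+n (suc n) = subst (2 ∣_) (rearrange n) (∣m∣n⇒∣m+n (2∣n*n+n n) (m∣m*n (suc n)))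
  where
  rearrange : ∀ n → (n * n + n) + 2 * suc n ≡ suc n * suc n + suc n
  rearrange = solve-∀

prime>2⇒odd : ∀ {p} → Prime p → 2 < p → ∃ λ h → p ≡ 1 + h * 2
prime>2⇒odd {p} p-prime 2<p with p % 2 in eq | m%n<n p 2 | m≡m%n+[m/n]*n p 2
... | 0 | _ | _ = contradiction (prime∣prime⇒≡ p-prime prime[2] (m%n≡0⇒n∣m p 2 eq)) (<⇒≢ 2<p)
... | 1 | _ | p≡ = p / 2 , p≡
... | suc (suc _) | s≤s (s≤s ()) | _

remainder-unique : ∀ {p a b} u v → a < p → b < p → a + u * p ≡ b + v * p → a ≡ b
remainder-unique {p} {a} {b} u v a<p b<p eq = begin
  a                ≡⟨ m<n⇒m%n≡m a<p ⟨
  a % p            ≡⟨ [m+kn]%n≡m%n a u p ⟨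
  (a + u * p) % p  ≡⟨ cong (_% p) eq ⟩
  (b + v * p) % p  ≡⟨ [m+kn]%n≡m%n b v p ⟩
  b % p            ≡⟨ m<n⇒m%n≡m b<p ⟩
  b                ∎
  where
  open ≡-Reasoning
  instance _ = >-nonZero (≤-trans z<s a<p)

-- Here x and y are the roots of t² − k p t + (M p − k); the smaller root y
-- satisfies k y ≤ 2 M, so for k ≥ 2 both k and y² are below p, and reducing
-- M p + y² = k y p + k modulo p gives y² = k.  For k = 1 that equation fails
-- modulo 2, M being even and p odd.
smallRoot⇒cube : ∀ {K p k x y} → Prime p → 2 < p → 2 * K * (2 * K) < p → 1 ≤ y → y ≤ x →
  x + y ≡ k * p → x * y + k ≡ 2 * K * p → PerfectCube (2 * K)
smallRoot⇒cube {K} {p} {k} {x} {y} p-prime 2<p M²<p 1≤y y≤x sum≡ prod≡ = cube k refl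
  where
  M = 2 * K
  instance
    p-nonZero : NonZero p
    p-nonZero = prime⇒nonZero p-prime

  quadratic : k + k * y * p ≡ y * y + M * p
  quadratic = begin
    k + k * y * p        ≡⟨ r₁ k y p ⟩
    k + k * p * y        ≡⟨ cong (λ s → k + s * y) sum≡ ⟨
    k + (x + y) * y      ≡⟨ r₂ k x y ⟩
    y * y + (x * y + k)  ≡⟨ cong (y * y +_) prod≡ ⟩
    y * y + M * p        ∎
    where
    open ≡-Reasoning
    r₁ : ∀ k y p → k + k * y * p ≡ k + k * p * y
    r₁ = solve-∀
    r₂ : ∀ k x y → k + (x + y) * y ≡ y * y + (x * y + k)
    r₂ = solve-∀

  -- As `y ≤ x`, `k * p * y = (x + y) * y ≤ 2 * (x * y) ≤ 2 * (M * p)`.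
  ky≤2M : k * y ≤ 2 * M
  ky≤2M = *-cancelʳ-≤ (k * y) (2 * M) p (begin
    k * y * p            ≡⟨ r₁ k y p ⟩
    k * p * y            ≡⟨ cong (_* y) sum≡ ⟨
    (x + y) * y          ≤⟨ *-monoˡ-≤ y (+-monoʳ-≤ x y≤x) ⟩
    (x + x) * y          ≡⟨ r₂ x y ⟩
    2 * (x * y)          ≤⟨ *-monoʳ-≤ 2 (m≤m+n (x * y) k) ⟩
    2 * (x * y + k)      ≡⟨ cong (2 *_) prod≡ ⟩
    2 * (M * p)          ≡⟨ *-assoc 2 M p ⟨
    2 * M * p            ∎)
    where
    open ≤-Reasoning
    r₁ : ∀ k y p → k * y * p ≡ k * p * y
    r₁ = solve-∀
    r₂ : ∀ x y → (x + x) * y ≡ 2 * (x * y)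
    r₂ = solve-∀

  -- This is `(x - 1) * (y - 1) ≥ 0`.
  x+y≤1+xy : ∀ {x y} → 1 ≤ x → 1 ≤ y → x + y ≤ 1 + x * y
  x+y≤1+xy {suc x} {suc y} _ _ = subst (suc x + suc y ≤_) (rearrange x y) (m≤m+n _ (x * y))
    where
    rearrange : ∀ x y → suc x + suc y + x * y ≡ 1 + suc x * suc y
    rearrange = solve-∀

  -- The two relations give `k * (p + 1) = x + y + k ≤ 1 + x * y + k = 1 + M *
  -- p`, which is less than `(M + 1) * (p + 1)`.
  k≤M : k ≤ M
  k≤M = ≮⇒≥ λ M<k → <-irrefl refl (begin-strict
    1 + M * p            <⟨ s≤s (m<n+m (M * p) (≤-trans (≤-trans z<s 2<p) (m≤m+n p M))) ⟩
    1 + (p + M + M * p)  ≡⟨ r₁ p M ⟩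
    suc M * p + suc M    ≤⟨ +-mono-≤ (*-monoˡ-≤ p M<k) M<k ⟩
    k * p + k            ≡⟨ cong (_+ k) sum≡ ⟨
    x + y + k            ≤⟨ +-monoˡ-≤ k (x+y≤1+xy (≤-trans 1≤y y≤x) 1≤y) ⟩
    1 + x * y + k        ≡⟨⟩
    1 + (x * y + k)      ≡⟨ cong suc prod≡ ⟩
    1 + M * p            ∎)
    where
    open ≤-Reasoning
    r₁ : ∀ p M → 1 + (p + M + M * p) ≡ suc M * p + suc M
    r₁ = solve-∀

  k<p : k < p
  k<p = ≤-<-trans (≤-trans k≤M (m≤m*m M)) M²<p
    where
    m≤m*m : ∀ m → m ≤ m * m
    m≤m*m zero    = z≤n
    m≤m*m (suc m) = m≤m*n (suc m) (suc m)

  -- From `2 * y ≤ k * y ≤ 2 * M`, squared.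
  y²<p : 2 ≤ k → y * y < p
  y²<p 2≤k = *-cancelˡ-< 4 (y * y) p (begin-strict
    4 * (y * y)          ≡⟨ r y ⟩
    2 * y * (2 * y)      ≤⟨ *-mono-≤ (*-monoˡ-≤ y 2≤k) (*-monoˡ-≤ y 2≤k) ⟩
    k * y * (k * y)      ≤⟨ *-mono-≤ ky≤2M ky≤2M ⟩
    2 * M * (2 * M)      ≡⟨ r M ⟨
    4 * (M * M)          <⟨ *-monoʳ-< 4 M²<p ⟩
    4 * p                ∎)
    where
    open ≤-Reasoning
    r : ∀ y → 4 * (y * y) ≡ 2 * y * (2 * y)
    r = solve-∀

  k≢1 : k ≢ 1
  k≢1 refl with prime>2⇒odd p-prime 2<p
  ... | h , p≡1+2h = contradiction (∣1⇒≡1 (∣m+n∣m⇒∣n 2∣even+1 (m∣m*n (y + h * y)))) λ ()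
    where
    r₁ : ∀ y h → 2 * (y + h * y) + 1 ≡ 1 + 1 * y * (1 + h * 2) + y
    r₁ = solve-∀
    r₂ : ∀ y K p → y * y + 2 * K * p + y ≡ 2 * (K * p) + (y * y + y)
    r₂ = solve-∀
    -- Adding `y` to both sides of `quadratic` completes `y * y` to the even number `y * y + y`,
    -- while the left side becomes odd.
    parity : 2 * (y + h * y) + 1 ≡ 2 * (K * p) + (y * y + y)
    parity = begin
      2 * (y + h * y) + 1           ≡⟨ r₁ y h ⟩
      1 + 1 * y * (1 + h * 2) + y   ≡⟨ cong (λ n → 1 + 1 * y * n + y) p≡1+2h ⟨
      1 + 1 * y * p + y             ≡⟨ cong (_+ y) quadratic ⟩
      y * y + 2 * K * p + y         ≡⟨ r₂ y K p ⟩
      2 * (K * p) + (y * y + y)     ∎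
      where open ≡-Reasoning
    2∣even+1 : 2 ∣ 2 * (y + h * y) + 1
    2∣even+1 = subst (2 ∣_) (sym parity) (∣m∣n⇒∣m+n (m∣m*n (K * p)) (2∣n*n+n y))

  cube : ∀ k′ → k ≡ k′ → PerfectCube M
  cube 0 k≡0 = contradiction (m+n≡0⇒n≡0 x (trans sum≡ (cong (_* p) k≡0))) (λ y≡0 → <⇒≢ 1≤y (sym y≡0))
  cube 1 k≡1 = contradiction k≡1 k≢1
  cube (suc (suc k″)) k≡ = y , (begin
    M            ≡⟨ *-cancelʳ-≡ (k * y) M p (+-cancelˡ-≡ k _ _ (trans quadratic (cong (_+ M * p) (sym k≡y²)))) ⟨
    k * y        ≡⟨ cong (_* y) k≡y² ⟩
    y * y * y    ≡⟨ r y ⟩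
    y ^ 3        ∎)
    where
    open ≡-Reasoning
    k≡y² : k ≡ y * y
    k≡y² = remainder-unique (k * y) M k<p (y²<p (subst (2 ≤_) (sym k≡) (s≤s (s≤s z≤n)))) quadratic
    r : ∀ y → y * y * y ≡ y * (y * (y * 1))
    r = solve-∀

-- Cancelling 1 and a factor `p` leaves `x * y * p + (x + y) = M * p * p`, hence `p ∣ x + y`; a
-- second cancellation gives the other relation. Both are symmetric, so either number may be the
-- smaller root.
factors≡1⇒cube : ∀ {K p x y} → Prime p → 2 < p → 2 * K * (2 * K) < p → 1 ≤ x → 1 ≤ y →
  (1 + x * p) * (1 + y * p) ≡ 1 + 2 * K * p ^ 3 → PerfectCube (2 * K)
factors≡1⇒cube {K} {p} {x} {y} p-prime 2<p M²<p 1≤x 1≤y eq = cube (≤-total x y)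
  where
  M = 2 * K
  instance
    p-nonZero : NonZero p
    p-nonZero = prime⇒nonZero p-prime

  xyp+x+y≡Mpp : x * y * p + (x + y) ≡ M * p * p
  xyp+x+y≡Mpp = *-cancelʳ-≡ _ _ p (suc-injective (begin
    1 + (x * y * p + (x + y)) * p  ≡⟨ r₁ x y p ⟩
    (1 + x * p) * (1 + y * p)      ≡⟨ eq ⟩
    1 + M * p ^ 3                  ≡⟨ r₂ M p ⟩
    1 + M * p * p * p              ∎))
    where
    open ≡-Reasoning
    r₁ : ∀ x y p → 1 + (x * y * p + (x + y)) * p ≡ (1 + x * p) * (1 + y * p)
    r₁ = solve-∀
    r₂ : ∀ M p → 1 + M * (p * (p * (p * 1))) ≡ 1 + M * p * p * p
    r₂ = solve-∀

  p∣x+y : p ∣ x + y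
  p∣x+y = ∣m+n∣m⇒∣n (subst (p ∣_) (sym xyp+x+y≡Mpp) (n∣m*n (M * p))) (n∣m*n (x * y))
  k = quotient p∣x+y
  sum≡ : x + y ≡ k * p
  sum≡ = _∣_.equality p∣x+y

  prod≡ : x * y + k ≡ M * p
  prod≡ = *-cancelʳ-≡ _ _ p (begin
    (x * y + k) * p        ≡⟨ *-distribʳ-+ p (x * y) k ⟩
    x * y * p + k * p      ≡⟨ cong (x * y * p +_) sum≡ ⟨
    x * y * p + (x + y)    ≡⟨ xyp+x+y≡Mpp ⟩
    M * p * p              ∎)
    where open ≡-Reasoning

  cube : x ≤ y ⊎ y ≤ x → PerfectCube M
  cube (inj₂ y≤x) = smallRoot⇒cube {K} {k = k} p-prime 2<p M²<p 1≤y y≤x sum≡ prod≡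
  cube (inj₁ x≤y) = smallRoot⇒cube {K} {k = k} p-prime 2<p M²<p 1≤x x≤y
    (trans (+-comm y x) sum≡) (trans (cong (_+ k) (*-comm y x)) prod≡)

-- The primality criterion with hypotheses on natural numbers.

_≡1[_]? : ∀ x n → Dec (x ≡1[ n ])
zero  ≡1[ n ]? = no λ { (_ , () , _) }
suc c ≡1[ n ]? with n ∣? c
... | yes n∣c = yes (c , refl , n∣c)
... | no  n∤c = no λ { (_ , refl , n∣c) → n∤c n∣c }

∃-crossing : ∀ {ℓ} {P : ℕ → Set ℓ} → (∀ i → Dec (P i)) → ∀ n → ¬ P 0 → P n →
  ∃ λ i → ¬ P i × P (suc i)
∃-crossing P? zero    ¬P0 Pn = contradiction Pn ¬P0
∃-crossing P? (suc n) ¬P0 Psn with P? n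
... | yes Pn = ∃-crossing P? n ¬P0 Pn
... | no ¬Pn = n , ¬Pn , Psn

primeCriterion : ∀ {a p K} → let N = 2 * K * p ^ 3 + 1 in
  1 < a → Prime p → 2 < p → 1 ≤ K → a ^ (2 * K) < N → 2 * K * (2 * K) < p →
  ¬ PerfectCube (2 * K) → a ^ (N ∸ 1) ≡1[ N ] → Prime N
primeCriterion {a} {p} {K} 1<a p-prime 2<p 1≤K aᴹ<N M²<p ¬cube aᴺ⁻¹≡1 = conclude
  where
  M = 2 * K
  N = M * p ^ 3 + 1
  P : ℕ → Set
  P i = a ^ (M * p ^ i) ≡1[ N ]
  instance
    N-nonZero : NonZero N
    N-nonZero = ≢-nonZero (λ N≡0 → contradiction (trans (+-comm 1 _) N≡0) λ ())
    a-nonZero : NonZero a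
    a-nonZero = >-nonZero (<⇒≤ 1<a)

  -- Since `1 < a ^ M < N`, the number `a ^ M - 1` is positive and below `N`, so it is no multiple
  -- of `N`.
  ¬P0 : ¬ P 0
  ¬P0 P0 with subst (λ e → a ^ e ≡1[ N ]) (*-identityʳ M) P0
  ... | zero  , aᴹ≡1 , _ with m^n≡1⇒n≡0∨m≡1 a M aᴹ≡1
  ...   | inj₁ M≡0 = <⇒≢ (≤-trans 1≤K (m≤n*m K 2)) (sym M≡0)
  ...   | inj₂ a≡1 = <⇒≢ 1<a (sym a≡1)
  ¬P0 P0 | suc c , aᴹ≡ , N∣ = <-irrefl refl (<-trans (≤-<-trans (∣⇒≤ N∣) (subst (suc c <_) (sym aᴹ≡) (n<1+n _))) aᴹ<N)

  P3 : P 3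
  P3 = subst (λ e → a ^ e ≡1[ N ]) (m+n∸n≡m (M * p ^ 3) 1) aᴺ⁻¹≡1

  p∤N : p ∤ N
  p∤N p∣N = prime∤1 p-prime (∣m+n∣m⇒∣n p∣N (∣n⇒∣m*n M (m∣m*n (p ^ 2))))

  conclude : Prime N
  -- At the crossing, `b = a ^ (M * p ^ i)` has order `p` modulo `N`.
  conclude with ∃-crossing (λ i → (a ^ (M * p ^ i)) ≡1[ N ]?) 3 ¬P0 P3
  ... | i , b≢1 , bᵖ≡1 with primeDivisor≡1 (a ^ (M * p ^ i)) p-prime p∤N b≢1 (subst _≡1[ N ] power bᵖ≡1)
    where
    rearrange : ∀ M p pⁱ → M * (p * pⁱ) ≡ M * pⁱ * p
    rearrange = solve-∀
    power : a ^ (M * p ^ suc i) ≡ (a ^ (M * p ^ i)) ^ p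
    power = trans (cong (a ^_) (rearrange M p (p ^ i))) (sym (^-*-assoc a (M * p ^ i) p))
  -- As `pred 0 = 0`, the condition `p ∣ pred q` admits `q = 0`, which is not prime; otherwise
  -- `q = 1 + x * p`.
  ... | zero , q-prime , _ = contradiction q-prime ¬prime[0]
  ... | suc .(x * p) , q-prime , divides zero N≡0 , divides x refl = contradiction N≡0 (≢-nonZero⁻¹ N)
  ... | suc .(x * p) , q-prime , divides (suc r) N≡ , divides x refl = cofactor x p∣r q-prime N≡
    where
    rearrange : ∀ r xp → suc r * suc xp ≡ (xp * suc r + r) + 1
    rearrange = solve-∀
    Mp³≡ : M * p ^ 3 ≡ x * p * suc r + r
    Mp³≡ = +-cancelʳ-≡ 1 _ _ (trans N≡ (rearrange r (x * p)))
    -- Both `N` and `q` are 1 modulo `p`, hence so is the cofactor `suc r`.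
    p∣r : p ∣ r
    p∣r = ∣m+n∣m⇒∣n (subst (p ∣_) Mp³≡ (∣n⇒∣m*n M (m∣m*n (p ^ 2)))) (∣m⇒∣m*n (suc r) (n∣m*n x))
    -- `x = 0` would make `q = 1`, and `r = 0` makes `N = q`; otherwise both factors are proper and
    -- `2 * K` is a cube.
    cofactor : ∀ x → p ∣ r → Prime (suc (x * p)) → N ≡ suc r * suc (x * p) → Prime N
    cofactor zero    _ q-prime _ = contradiction q-prime ¬prime[1]
    cofactor (suc x) (divides zero refl) q-prime N≡ =
      subst Prime (sym (trans N≡ (*-identityˡ _))) q-prime
    cofactor (suc x) (divides (suc y) refl) _ N≡ =
      contradiction (factors≡1⇒cube {K} {x = suc y} {suc x} p-prime 2<p M²<p z<s z<s (trans (sym N≡) (+-comm _ 1))) ¬cube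

-- From inequalities between cuts to inequalities between natural numbers.

-- Rules out negative numerators, so that only the branch for `+ m` of the cut of `log` matters; the
-- denominator is `suc d`.
ℕ<ℚᵘ : ∀ {n q} → ℤ.+ n ℚ./ 1 ℚ.< q → ∃₂ λ m d → q ≡ mkℚᵘ (ℤ.+ m) d × n * suc d < m
ℕ<ℚᵘ {n} {mkℚᵘ (ℤ.+ m) d} (ℚ.*<* n<q) = m , d , refl ,
  ℤ.drop‿+<+ (subst₂ ℤ._<_ (sym (ℤ.pos-* n (suc d))) (ℤ.*-identityʳ (ℤ.+ m)) n<q)
ℕ<ℚᵘ {n} {mkℚᵘ ℤ.-[1+ m ] d} (ℚ.*<* n<q)
  with () ← subst (ℤ._< ℤ.-[1+ m ] ℤ.* ℤ.+ 1) (sym (ℤ.pos-* n (suc d))) n<q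

-- If `x ≤ a ^ n`, then `n < m / suc d` gives `x ^ suc d ≤ a ^ m`, so `m / suc d` is not below the
-- logarithm.
fromℕ<ᴿlog⇒^< : ∀ {n a x} → 1 < a → fromℕ n <ᴿ log a x → a ^ n < x
fromℕ<ᴿlog⇒^< {n} {a} {x} 1<a (q , n<q , q<log) with ℕ<ℚᵘ {n} {q} n<q
... | m , d , refl , nd<m = ≰⇒> λ x≤aⁿ → <-irrefl refl (begin-strict
  a ^ m              <⟨ q<log ⟩
  x ^ suc d          ≤⟨ ^-monoˡ-≤ (suc d) x≤aⁿ ⟩
  (a ^ n) ^ suc d    ≡⟨ ^-*-assoc a n (suc d) ⟩
  a ^ (n * suc d)    ≤⟨ ^-monoʳ-≤ a (<⇒≤ nd<m) ⟩
  a ^ m              ∎)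
  where
  open ≤-Reasoning
  instance _ = >-nonZero (<⇒≤ 1<a)

fromℕ<ᴿ√⇒²< : ∀ {n p} → fromℕ n <ᴿ √ p → n * n < p
fromℕ<ᴿ√⇒²< {n} {p} (q , n<q , q<√p) with ℕ<ℚᵘ {n} {q} n<q
-- The separating rational exceeds a natural number, so it is not negative.
fromℕ<ᴿ√⇒²< (_ , _ , inj₁ (ℚ.*<* q<0)) | m , d , refl , _
  with () ← ℤ.drop‿+<+ (subst (ℤ._< ℤ.+ 0) (ℤ.*-identityʳ (ℤ.+ m)) q<0)
fromℕ<ᴿ√⇒²< {n} {p} (_ , _ , inj₂ (ℚ.*<* q²<p)) | m , d , refl , nd<m =
  *-cancelʳ-< (suc d * suc d) (n * n) p (begin-strict
    n * n * (suc d * suc d)        ≡⟨ rearrange n (suc d) ⟩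
    n * suc d * (n * suc d)        ≤⟨ *-mono-≤ (<⇒≤ nd<m) (<⇒≤ nd<m) ⟩
    m * m                          <⟨ ℤ.drop‿+<+ (subst₂ ℤ._<_ lhs (sym (ℤ.pos-* p (suc d * suc d))) q²<p) ⟩
    p * (suc d * suc d)            ∎)
  where
  open ≤-Reasoning
  rearrange : ∀ n e → n * n * (e * e) ≡ n * e * (n * e)
  rearrange = solve-∀
  lhs : ℤ.+ m ℤ.* ℤ.+ m ℤ.* ℤ.+ 1 ≡ ℤ.+ (m * m)
  lhs = trans (ℤ.*-identityʳ _) (sym (ℤ.pos-* m m))

-- A rational above the root is positive by the definition of its cut, so `s > 0` and
-- `m < r < r + s = q < p`.
fromℕ+ᴿ·ᴿ√<ᴿ⇒< : ∀ {m n p} c .{{_ : NonZero c}} → fromℕ m +ᴿ c ·ᴿ √ n <ᴿ fromℕ p → m < p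
fromℕ+ᴿ·ᴿ√<ᴿ⇒< {m} {n} {p} c@(suc _)
  (q , (r , s , m<r , (t , (0<t , _) , s≃ct) , q≃r+s) , q<p) =
  ℤ.drop‿+<+ (subst₂ ℤ._<_ (ℤ.*-identityʳ (ℤ.+ m)) (ℤ.*-identityʳ (ℤ.+ p)) (ℚ.drop-*<* m<p))
  where
  0<s : ℚ.0ℚᵘ ℚ.< s
  0<s = ℚ.<-respʳ-≃ (ℚ.≃-sym s≃ct) (ℚ.<-respˡ-≃ (ℚ.*-zeroʳ (ℤ.+ c ℚ./ 1)) (ℚ.*-monoʳ-<-pos (ℤ.+ c ℚ./ 1) 0<t))
  r<q : r ℚ.< q
  r<q = ℚ.<-respʳ-≃ (ℚ.≃-sym q≃r+s) (ℚ.<-respˡ-≃ (ℚ.+-identityʳ r) (ℚ.+-monoʳ-< r 0<s))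
  m<p : ℤ.+ m ℚ./ 1 ℚ.< ℤ.+ p ℚ./ 1
  m<p = ℚ.<-trans m<r (ℚ.<-trans r<q q<p)

-- For `x = suc c` the integer difference computes to `+ c`, so the given divisibility is already
-- `n ∣ c`.
≡1[mod]⇒≡1 : ∀ {x n} → 0 < x → x ≡ 1 [mod n ] → x ≡1[ n ]
≡1[mod]⇒≡1 {suc c} _ n∣c = c , refl , n∣c

corollary3p5 : (a p K : ℕ) →
    let N = 2 * K * p ^ 3 + 1 in
    1 < a →
    Prime p →
    fromℕ 11 +ᴿ 4 ·ᴿ √ 7 <ᴿ fromℕ p →
    1 ≤ K →
    fromℕ (2 * K) <ᴿ log a N →
    fromℕ (2 * K) <ᴿ √ p →
    ¬ PerfectCube (2 * K) →
    a ^ (N ∸ 1) ≡ 1 [mod N ] →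
    Prime N
corollary3p5 a p K 1<a p-prime 11+4√7<p 1≤K 2K<log 2K<√p ¬cube aᴺ⁻¹≡1 =
  primeCriterion {K = K} 1<a p-prime 2<p 1≤K (fromℕ<ᴿlog⇒^< 1<a 2K<log) (fromℕ<ᴿ√⇒²< 2K<√p) ¬cube
    (≡1[mod]⇒≡1 (m^n>0 a {{>-nonZero (<⇒≤ 1<a)}} (N ∸ 1)) aᴺ⁻¹≡1)
  where
  N = 2 * K * p ^ 3 + 1
  2<p : 2 < p
  2<p = ≤-trans (s≤s (s≤s (s≤s z≤n))) (fromℕ+ᴿ·ᴿ√<ᴿ⇒< {11} {7} 4 11+4√7<p)
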